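{- Every poset matrix $A\in\mathcal{PM}(n)$ is an induced principal submatrix of the binary Pascal matrix $\mathbf{P}_{2^n}$. More precisely, there exists an index set $\alpha=(\alpha_0,\ldots,\alpha_{n-1})\in Q_{n,2^n}$ with $2^i\le\alpha_i<2^{i+1}$ for all $i\in\{0,\ldots,n-1\}$ such that $A=\mathbf{P}_{2^n}[\alpha]$, where $\alpha$ is determined by $$A(2^0,2^1,\ldots,2^{n-1})^T=(\alpha_0,\ldots,\alpha_{n-1})^T$$ (the matrix-vector product being computed over the integers).
   Context: Let $X_n=\{0,1,\ldots,n-1\}$. $\mathcal{PM}(n)$ denotes the set of $n\times n$ $(0,1)$-matrices $A=[a_{ij}]_{0\le i,j\le n-1}$ that are lower triangular with all diagonal entries $1$ and transitive ($a_{ij}=1$ and $a_{jk}=1$ imply $a_{ik}=1$); these are the poset matrices ($a_{ij}=1$ iff $j\preceq i$) of partial orders $\preceq$ on $X_n$ for which $x\preceq y$ implies $x\le y$. The binary Pascal matrix $\mathbf{P}_m$ is the $m\times m$ $(0,1)$-matrix with $(\mathbf{P}_m)_{i,j}\equiv\binom{i}{j}\pmod 2$ for $0\le i,j\le m-1$. $Q_{k,m}$ is the collection of $k$-element subsets of $X_m$, also written as vectors $(\alpha_0,\ldots,\alpha_{k-1})$. $M[\alpha]$ denotes the submatrix of $M$ with rows and columns indexed by $\alpha$, i.e. $(M[\alpha])_{i,j}=M_{\alpha_i,\alpha_j}$. -}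

module Defs where

open import Algebra.Properties.Semiring.Sum using (sum)
open import Data.Fin.Base as Fin using (Fin; toℕ)
open import Data.Nat.Base using (ℕ; _*_; _^_; _%_)
open import Data.Nat.Combinatorics using (_C_)
open import Data.Nat.Properties using (+-*-semiring)
open import Data.Sum.Base using (_⊎_)
open import Data.Vec.Functional using (Vector)
open import Relation.Binary.PropositionalEquality using (_≡_)

-- Entries are natural numbers, so that products are computed over the
-- integers; (0,1)-matrices are singled out by `IsBinary`.

Matrix : ℕ → Set
Matrix n = Fin n → Fin n → ℕ

infix 4 _≈ₘ_

_≈ₘ_ : ∀ {n} → Matrix n → Matrix n → Set
A ≈ₘ B = ∀ i j → A i j ≡ B i j

IsBinary : ∀ {n} → Matrix n → Set
IsBinary A = ∀ i j → A i j ≡ 0 ⊎ A i j ≡ 1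

-- Membership in 𝒫ℳ(n).

record IsPosetMatrix {n : ℕ} (A : Matrix n) : Set where
  field
    binary          : IsBinary A
    lowerTriangular : ∀ i j → i Fin.< j → A i j ≡ 0
    diagonal        : ∀ i → A i i ≡ 1
    transitive      : ∀ i j k → A i j ≡ 1 → A j k ≡ 1 → A i k ≡ 1

binaryPascal : ∀ m → Matrix m
binaryPascal m i j = (toℕ i C toℕ j) % 2

-- A k-element subset of {0,…,m-1} is encoded by the vector listing its
-- elements in increasing order.

record Q (k m : ℕ) : Set where
  field
    index      : Vector (Fin m) k
    increasing : ∀ i j → i Fin.< j → index i Fin.< index j

open Q public using (index)

infix 8 _[_]

_[_] : ∀ {k m} → Matrix m → Q k m → Matrix k
(M [ α ]) i j = M (index α i) (index α j)

infixr 7 _*ᵥ_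

_*ᵥ_ : ∀ {n} → Matrix n → Vector ℕ n → Vector ℕ n
(A *ᵥ v) i = sum +-*-semiring (λ j → A i j * v j)

powersOfTwo : ∀ n → Vector ℕ n
powersOfTwo n j = 2 ^ toℕ j

{-# OPTIONS --safe #-}

-- The vector α = A (2⁰, …, 2ⁿ⁻¹)ᵀ lists the integers whose binary digits are
-- the rows of A.  By Lucas' theorem modulo 2, αᵢ C αⱼ is odd iff the digits of
-- αⱼ are dominated by those of αᵢ, i.e. iff row j of A is contained in row i.
-- Transitivity gives the containment when A i j ≡ 1, and the diagonal entry
-- A j j ≡ 1 violates it when A i j ≡ 0.
module Submission where

open import Defs
open import Data.Fin.Base as Fin using (Fin; zero; suc; fromℕ<; toℕ)
open import Data.Fin.Properties using (toℕ-fromℕ<; toℕ<n)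
open import Data.Nat.Base
  using (ℕ; zero; suc; _+_; _*_; _^_; _%_; _≤_; _<_; z≤n; s≤s)
open import Data.Nat.Combinatorics using (_C_; nCk+nC[k+1]≡[n+1]C[k+1]; nCk≡nC[n∸k]; nCn≡1; nC1≡n)
open import Data.Nat.DivMod using (%-distribˡ-+; %-distribˡ-*; [m+kn]%n≡m%n; m*n%n≡0)
open import Data.Nat.Properties
open import Data.Nat.Tactic.RingSolver using (solve-∀)
open import Algebra.Properties.Semiring.Sum +-*-semiring
  using (sum; sum-cong-≗; sum-remove; *-distribʳ-sum)
open import Data.Product.Base using (Σ-syntax; _×_; _,_)
open import Data.Sum.Base using (_⊎_; inj₁; inj₂)
open import Data.Vec.Functional using (Vector; head; tail; removeAt)
open import Function.Base using (_∘_)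
open import Relation.Binary.PropositionalEquality
  using (_≡_; refl; sym; trans; cong; cong₂; subst; module ≡-Reasoning)

private
  variable
    n : ℕ

  +-cong-%2 : ∀ a b c d → a % 2 ≡ b % 2 → c % 2 ≡ d % 2 → (a + c) % 2 ≡ (b + d) % 2
  +-cong-%2 a b c d p q = begin
    (a + c) % 2          ≡⟨ %-distribˡ-+ a c 2 ⟩
    (a % 2 + c % 2) % 2  ≡⟨ cong₂ (λ x y → (x + y) % 2) p q ⟩
    (b % 2 + d % 2) % 2  ≡⟨ %-distribˡ-+ b d 2 ⟨
    (b + d) % 2          ∎
    where open ≡-Reasoning

nC0≡1 : ∀ n → n C 0 ≡ 1
nC0≡1 n = trans (nCk≡nC[n∸k] {0} {n} z≤n) (nCn≡1 n)

-- Two applications of Pascal's rule produce the middle term `n C (1 + k)` twice, so it cancels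
-- modulo 2. This is the coefficient form of (1 + x)² ≡ 1 + x², and it lets the parity lemmas below
-- advance both indices in steps of two.
[n+2]C[k+2]%2 : ∀ n k → ((2 + n) C (2 + k)) % 2 ≡ (n C k + n C (2 + k)) % 2
[n+2]C[k+2]%2 n k = begin
  ((2 + n) C (2 + k)) % 2                                     ≡⟨ cong (_% 2) (pascal (1 + n) (1 + k)) ⟩
  ((1 + n) C (1 + k) + (1 + n) C (2 + k)) % 2                 ≡⟨ cong₂ (λ x y → (x + y) % 2) (pascal n k) (pascal n (1 + k)) ⟩
  ((n C k + n C (1 + k)) + (n C (1 + k) + n C (2 + k))) % 2   ≡⟨ cong (_% 2) (regroup (n C k) (n C (1 + k)) (n C (2 + k))) ⟩
  (n C k + n C (2 + k) + (n C (1 + k)) * 2) % 2               ≡⟨ [m+kn]%n≡m%n (n C k + n C (2 + k)) (n C (1 + k)) 2 ⟩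
  (n C k + n C (2 + k)) % 2                                   ∎
  where
  open ≡-Reasoning
  pascal : ∀ n k → (1 + n) C (1 + k) ≡ n C k + n C (1 + k)
  pascal n k = sym (nCk+nC[k+1]≡[n+1]C[k+1] n k)
  regroup : ∀ x y z → (x + y) + (y + z) ≡ x + z + y * 2
  regroup = solve-∀

-- On doubled indices the two-step recurrence is exactly Pascal's rule for the halves, so both sides
-- obey the same recursion.
even-C-even : ∀ a b → ((a * 2) C (b * 2)) % 2 ≡ (a C b) % 2
even-C-even zero    zero    = refl
even-C-even zero    (suc b) = refl
even-C-even (suc a) zero    = cong (_% 2) (trans (nC0≡1 (suc a * 2)) (sym (nC0≡1 (suc a))))
even-C-even (suc a) (suc b) = begin
  ((suc a * 2) C (suc b * 2)) % 2                  ≡⟨ [n+2]C[k+2]%2 (a * 2) (b * 2) ⟩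
  ((a * 2) C (b * 2) + (a * 2) C (suc b * 2)) % 2  ≡⟨ +-cong-%2 ((a * 2) C (b * 2)) (a C b) ((a * 2) C (suc b * 2)) (a C suc b)
                                                        (even-C-even a b) (even-C-even a (suc b)) ⟩
  (a C b + a C suc b) % 2                          ≡⟨ cong (_% 2) (nCk+nC[k+1]≡[n+1]C[k+1] a b) ⟩
  (suc a C suc b) % 2                              ∎
  where open ≡-Reasoning

-- The two-step recurrence keeps the lower index odd, so the induction ends either in row 0 or at
-- lower index 1, where the coefficient is the even number `suc a * 2`.
even-C-odd : ∀ a b → ((a * 2) C (1 + b * 2)) % 2 ≡ 0
even-C-odd zero    b       = refl
even-C-odd (suc a) zero    = trans (cong (_% 2) (nC1≡n (suc a * 2))) (m*n%n≡0 (suc a) 2)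
even-C-odd (suc a) (suc b) = begin
  ((suc a * 2) C (1 + suc b * 2)) % 2                      ≡⟨ [n+2]C[k+2]%2 (a * 2) (1 + b * 2) ⟩
  ((a * 2) C (1 + b * 2) + (a * 2) C (1 + suc b * 2)) % 2  ≡⟨ +-cong-%2 ((a * 2) C (1 + b * 2)) 0 ((a * 2) C (1 + suc b * 2)) 0
                                                                (even-C-odd a b) (even-C-odd a (suc b)) ⟩
  0                                                        ∎
  where open ≡-Reasoning

-- One step of Pascal's rule leads back to an even row, where the summand with odd lower index
-- vanishes; `odd-C-even` works the same way.
odd-C-odd : ∀ a b → ((1 + a * 2) C (1 + b * 2)) % 2 ≡ (a C b) % 2
odd-C-odd a b = begin
  ((1 + a * 2) C (1 + b * 2)) % 2                  ≡⟨ cong (_% 2) (nCk+nC[k+1]≡[n+1]C[k+1] (a * 2) (b * 2)) ⟨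
  ((a * 2) C (b * 2) + (a * 2) C (1 + b * 2)) % 2  ≡⟨ +-cong-%2 ((a * 2) C (b * 2)) (a C b) ((a * 2) C (1 + b * 2)) 0
                                                        (even-C-even a b) (even-C-odd a b) ⟩
  (a C b + 0) % 2                                  ≡⟨ cong (_% 2) (+-identityʳ (a C b)) ⟩
  (a C b) % 2                                      ∎
  where open ≡-Reasoning

odd-C-even : ∀ a b → ((1 + a * 2) C (b * 2)) % 2 ≡ (a C b) % 2
odd-C-even a zero    = cong (_% 2) (trans (nC0≡1 (1 + a * 2)) (sym (nC0≡1 a)))
odd-C-even a (suc b) = begin
  ((1 + a * 2) C (suc b * 2)) % 2                      ≡⟨ cong (_% 2) (nCk+nC[k+1]≡[n+1]C[k+1] (a * 2) (1 + b * 2)) ⟨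
  ((a * 2) C (1 + b * 2) + (a * 2) C (suc b * 2)) % 2  ≡⟨ +-cong-%2 ((a * 2) C (1 + b * 2)) 0 ((a * 2) C (suc b * 2)) (a C suc b)
                                                            (even-C-odd a b) (even-C-even a (suc b)) ⟩
  (a C suc b) % 2                                      ∎
  where open ≡-Reasoning

Bit : ℕ → Set
Bit r = r ≡ 0 ⊎ r ≡ 1

-- The factor `r C s` is 0 exactly for `r` = 0, `s` = 1, the one parity pattern that forces an even
-- coefficient; in the other three it is 1.
lucas-%2 : ∀ {r s} a b → Bit r → Bit s →
  ((r + a * 2) C (s + b * 2)) % 2 ≡ ((r C s) * (a C b)) % 2
lucas-%2 a b (inj₁ refl) (inj₁ refl) = trans (even-C-even a b) (cong (_% 2) (sym (*-identityˡ (a C b))))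
lucas-%2 a b (inj₁ refl) (inj₂ refl) = even-C-odd a b
lucas-%2 a b (inj₂ refl) (inj₁ refl) = trans (odd-C-even a b) (cong (_% 2) (sym (*-identityˡ (a C b))))
lucas-%2 a b (inj₂ refl) (inj₂ refl) = trans (odd-C-odd a b) (cong (_% 2) (sym (*-identityˡ (a C b))))

-- Digits are listed least significant first. `value (A i)` unfolds to `(A *ᵥ powersOfTwo n) i`, so
-- the two are interchangeable definitionally.
value : Vector ℕ n → ℕ
value f = sum (λ j → f j * 2 ^ toℕ j)

value-suc : (f : Vector ℕ (suc n)) → value f ≡ head f + value (tail f) * 2
value-suc f = cong₂ _+_ (*-identityʳ (head f)) (begin
  sum (λ j → tail f j * (2 * 2 ^ toℕ j))  ≡⟨ sum-cong-≗ (λ j → shift (tail f j) (2 ^ toℕ j)) ⟩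
  sum (λ j → tail f j * 2 ^ toℕ j * 2)    ≡⟨ *-distribʳ-sum 2 (λ j → tail f j * 2 ^ toℕ j) ⟨
  value (tail f) * 2                      ∎)
  where
  open ≡-Reasoning
  shift : ∀ x y → x * (2 * y) ≡ x * y * 2
  shift = solve-∀

-- Each factor carries its own `% 2`, so that an induction hypothesis about the tails can be
-- substituted directly.
value-C-suc-%2 : (f g : Vector ℕ (suc n)) → (∀ j → Bit (f j)) → (∀ j → Bit (g j)) →
  (value f C value g) % 2 ≡
  ((head f C head g) % 2 * ((value (tail f) C value (tail g)) % 2)) % 2
value-C-suc-%2 f g f-bit g-bit = begin
  (value f C value g) % 2                          ≡⟨ cong₂ (λ x y → (x C y) % 2) (value-suc f) (value-suc g) ⟩
  ((head f + a * 2) C (head g + b * 2)) % 2        ≡⟨ lucas-%2 a b (f-bit zero) (g-bit zero) ⟩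
  ((head f C head g) * (a C b)) % 2                ≡⟨ %-distribˡ-* (head f C head g) (a C b) 2 ⟩
  ((head f C head g) % 2 * ((a C b) % 2)) % 2      ∎
  where
  open ≡-Reasoning
  a = value (tail f)
  b = value (tail g)

-- Every digit contributes `r C 0` or `1 C 1` to the Lucas product, hence 1.
value-C-odd : (f g : Vector ℕ n) → (∀ j → Bit (f j)) → (∀ j → Bit (g j)) →
  (∀ j → g j ≡ 1 → f j ≡ 1) → (value f C value g) % 2 ≡ 1
value-C-odd {zero}  f g f-bit g-bit g⊆f = refl
value-C-odd {suc n} f g f-bit g-bit g⊆f = trans (value-C-suc-%2 f g f-bit g-bit)
  (cong₂ (λ x y → (x % 2 * y) % 2)
    (head-C (f-bit zero) (g-bit zero) (g⊆f zero))
    (value-C-odd (tail f) (tail g) (f-bit ∘ suc) (g-bit ∘ suc) (g⊆f ∘ suc)))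
  where
  head-C : ∀ {r s} → Bit r → Bit s → (s ≡ 1 → r ≡ 1) → r C s ≡ 1
  head-C {r} _ (inj₁ refl) _ = nC0≡1 r
  head-C _ (inj₂ refl) s⇒r rewrite s⇒r refl = refl

-- The single position `j` contributes `0 C 1`, which is 0 and annihilates the whole Lucas product.
value-C-even : (f g : Vector ℕ n) → (∀ j → Bit (f j)) → (∀ j → Bit (g j)) →
  ∀ j → g j ≡ 1 → f j ≡ 0 → (value f C value g) % 2 ≡ 0
value-C-even f g f-bit g-bit zero gj≡1 fj≡0 = trans (value-C-suc-%2 f g f-bit g-bit)
  (cong₂ (λ x y → ((x C y) % 2 * ((value (tail f) C value (tail g)) % 2)) % 2) fj≡0 gj≡1)
value-C-even f g f-bit g-bit (suc j) gj≡1 fj≡0 = trans (value-C-suc-%2 f g f-bit g-bit)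
  (trans
    (cong (λ y → ((head f C head g) % 2 * y) % 2)
      (value-C-even (tail f) (tail g) (f-bit ∘ suc) (g-bit ∘ suc) j gj≡1 fj≡0))
    (cong (_% 2) (*-zeroʳ ((head f C head g) % 2))))

2^j≤value : (f : Vector ℕ n) → ∀ j → f j ≡ 1 → 2 ^ toℕ j ≤ value f
2^j≤value {suc n} f j fj≡1 = begin
  2 ^ toℕ j                          ≡⟨ *-identityˡ (2 ^ toℕ j) ⟨
  1 * 2 ^ toℕ j                      ≡⟨ cong (_* 2 ^ toℕ j) fj≡1 ⟨
  t j                                ≤⟨ m≤m+n (t j) (sum (removeAt t j)) ⟩
  t j + sum (removeAt t j)           ≡⟨ sum-remove {i = j} t ⟨
  value f                            ∎
  where
  open ≤-Reasoning
  t : Vector ℕ (suc n)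
  t k = f k * 2 ^ toℕ k

-- The bound `m` is independent of the length `n`: a row of `A` has `n` entries, but only those up
-- to the diagonal can be nonzero.
value<2^m : ∀ m (f : Vector ℕ n) → (∀ j → Bit (f j)) → (∀ j → m ≤ toℕ j → f j ≡ 0) →
  value f < 2 ^ m
value<2^m {zero}  m       f f-bit vanish = m^n>0 2 m
value<2^m {suc n} zero    f f-bit vanish = begin-strict
  value f                      ≡⟨ value-suc f ⟩
  head f + value (tail f) * 2  ≡⟨ cong₂ (λ x y → x + y * 2) (vanish zero z≤n) (n<1⇒n≡0 tail<1) ⟩
  0                            <⟨ s≤s z≤n ⟩
  1                            ∎
  where
  open ≤-Reasoning
  tail<1 : value (tail f) < 1
  tail<1 = value<2^m 0 (tail f) (f-bit ∘ suc) (λ j _ → vanish (suc j) z≤n)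
value<2^m {suc n} (suc m) f f-bit vanish = begin-strict
  value f                      ≡⟨ value-suc f ⟩
  -- A digit is below 2, and 2 plus twice the tail value is `suc (value (tail f)) * 2`; the strict
  -- bound on the tail then absorbs the successor.
  head f + value (tail f) * 2  <⟨ +-monoˡ-< (value (tail f) * 2) (bit<2 (f-bit zero)) ⟩
  suc (value (tail f)) * 2     ≤⟨ *-monoˡ-≤ 2 (value<2^m m (tail f) (f-bit ∘ suc) (λ j m≤j → vanish (suc j) (s≤s m≤j))) ⟩
  2 ^ m * 2                    ≡⟨ *-comm (2 ^ m) 2 ⟩
  2 ^ suc m                    ∎
  where
  open ≤-Reasoning
  bit<2 : ∀ {r} → Bit r → r < 2
  bit<2 (inj₁ refl) = s≤s z≤n
  bit<2 (inj₂ refl) = s≤s (s≤s z≤n)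

theorem3p1 : ∀ (n : ℕ) (A : Matrix n) → IsPosetMatrix A →
    Σ[ α ∈ Q n (2 ^ n) ]
    ((∀ i → 2 ^ toℕ i ≤ toℕ (index α i) × toℕ (index α i) < 2 ^ suc (toℕ i))
    × A ≈ₘ binaryPascal (2 ^ n) [ α ]
    × (∀ i → (A *ᵥ powersOfTwo n) i ≡ toℕ (index α i)))
theorem3p1 n A isPoset =
  α , (λ i → lower i , upper i) , A≈P[α] , (λ i → sym (toℕ-index i))
  where
  open IsPosetMatrix isPoset

  value<2^1+i : ∀ i → value (A i) < 2 ^ suc (toℕ i)
  -- `i Fin.< j` unfolds to `suc (toℕ i) ≤ toℕ j`, so lower triangularity is literally the vanishing
  -- hypothesis for the bound `suc (toℕ i)`.
  value<2^1+i i = value<2^m (suc (toℕ i)) (A i) (binary i) (lowerTriangular i)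

  value<2^n : ∀ i → value (A i) < 2 ^ n
  value<2^n i = <-≤-trans (value<2^1+i i) (^-monoʳ-≤ 2 (toℕ<n i))

  ix : Vector (Fin (2 ^ n)) n
  ix i = fromℕ< (value<2^n i)

  toℕ-index : ∀ i → toℕ (ix i) ≡ value (A i)
  toℕ-index i = toℕ-fromℕ< (value<2^n i)

  lower : ∀ i → 2 ^ toℕ i ≤ toℕ (ix i)
  lower i = subst (2 ^ toℕ i ≤_) (sym (toℕ-index i)) (2^j≤value (A i) i (diagonal i))

  upper : ∀ i → toℕ (ix i) < 2 ^ suc (toℕ i)
  upper i = subst (_< 2 ^ suc (toℕ i)) (sym (toℕ-index i)) (value<2^1+i i)

  α : Q n (2 ^ n)
  α = record
    { index      = ix
    -- The dyadic intervals from `lower` and `upper` are disjoint and ordered: αᵢ < 2^(1+i) ≤ 2^j ≤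
    -- αⱼ.
    ; increasing = λ i j i<j → <-≤-trans (upper i) (≤-trans (^-monoʳ-≤ 2 i<j) (lower j))
    }

  A≡value-C : ∀ i j → A i j ≡ (value (A i) C value (A j)) % 2
  A≡value-C i j with binary i j
  ... | inj₁ Aij≡0 = trans Aij≡0
    (sym (value-C-even (A i) (A j) (binary i) (binary j) j (diagonal j) Aij≡0))
  ... | inj₂ Aij≡1 = trans Aij≡1
    (sym (value-C-odd (A i) (A j) (binary i) (binary j) (λ k → transitive i j k Aij≡1)))

  A≈P[α] : A ≈ₘ binaryPascal (2 ^ n) [ α ]
  A≈P[α] i j = trans (A≡value-C i j)
    (sym (cong₂ (λ x y → (x C y) % 2) (toℕ-index i) (toℕ-index j)))
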